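{- Let $P_0\in\Sigma_\psi$ be invertible, and let $(p_n)_{n\ge0}$ be the $\partial_\psi$-basic polynomial sequence of a $\partial_\psi$-delta operator $Q$. Suppose that for all $n>0$ $$\big[x^{ -1}p_n(x)\big]_{x=0}=n_\psi\big[P_0^{ -1}p_{n-1}(x)\big]_{x=0},$$ where $[x^{ -1}p(x)]_{x=0}$ denotes the coefficient of $x$ in $p$. Then $Q=\partial_\psi P_0$, i.e. $(p_n)$ is the $\partial_\psi$-basic polynomial sequence of the $\partial_\psi$-delta operator $\partial_\psi P_0$.
   Context: Let $F$ be a field of characteristic $0$, $P=F[x]$. Fix $(\psi_n)_{n\ge0}$ in $F$ with $\psi_0=1$, $\psi_n\ne0$, $\psi_{ -1}=0$; $n_\psi=\psi_{n-1}/\psi_n$, $n_\psi!=1/\psi_n$, $0_\psi!=1$. $\partial_\psi x^n=n_\psi x^{n-1}$ (linear); $E^a(\partial_\psi)=\sum_k\frac{a^k}{k_\psi!}\partial_\psi^k$. $\Sigma_\psi$: algebra of linear operators on $P$ commuting with all $E^a(\partial_\psi)$, $a\in F$. A $\partial_\psi$-delta operator is $Q\in\Sigma_\psi$ with $Q(x)$ a nonzero constant; its $\partial_\psi$-basic sequence: $\deg p_n=n$, $p_0=1$, $p_n(0)=0$ for $n>0$, $Qp_n=n_\psi p_{n-1}$.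
   Formalization: The formal theorem additionally assumes ψ_1 = 1 (so 1_ψ = 1); without it the claim is false, e.g. ψ_n = 2^{ -n}, Q = ∂_ψ, p_n = x^n, P_0 = 2·id satisfies the hypotheses but ∂_ψ P_0 = 2∂_ψ ≠ Q. -}

module Defs where

open import Algebra.Apartness.Bundles using (HeytingField; module HeytingCommutativeRing)
open import Algebra.Bundles using (module CommutativeRing; module Semiring)
open import Algebra.Module.Bundles.Raw using (RawLeftModule)
open import Algebra.Module.Morphism.Structures using (module LeftModuleMorphisms)
import Algebra.Definitions.RawSemiring as RawSemiringOperations
open import Data.List.Base using (List; []; _∷_; foldr; length; map; upTo)
open import Data.Nat.Base as ℕ using (ℕ; zero; suc)
open import Data.Nat.GeneralisedArithmetic using (fold)
open import Data.Product.Base using (_×_; ∃-syntax; proj₁)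
open import Function.Base using (_∘_)
open import Level using (Level; _⊔_)

private
  variable
    c ℓ₁ ℓ₂ : Level

module Field (F : HeytingField c ℓ₁ ℓ₂) where

  open HeytingField F public
    using (Carrier; _≈_; _#_; _+_; _*_; -_; 0#; 1#; #⇒invertible; heytingCommutativeRing)
  open HeytingCommutativeRing heytingCommutativeRing using (commutativeRing)
  open RawSemiringOperations (Semiring.rawSemiring (CommutativeRing.semiring commutativeRing)) public
    using (_^_) renaming (_×_ to _·_)

  CharZero : Set ℓ₂
  CharZero = ∀ n → (suc n · 1#) # 0#

  -- #⇒invertible inverts x - 0#, which is equal to x.
  inverse : ∀ {x} → x # 0# → Carrier
  inverse x#0 = proj₁ (#⇒invertible x#0)

module Polynomial (F : HeytingField c ℓ₁ ℓ₂) where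

  open Field F

  -- Coefficients in increasing degree.  Trailing zeros are allowed, so
  -- equality of polynomials is _≈ₚ_ and not equality of lists.
  Poly : Set c
  Poly = List Carrier

  coeff : Poly → ℕ → Carrier
  coeff []       _       = 0#
  coeff (a ∷ _)  zero    = a
  coeff (_ ∷ as) (suc n) = coeff as n

  infix 4 _≈ₚ_
  _≈ₚ_ : Poly → Poly → Set ℓ₁
  p ≈ₚ q = ∀ n → coeff p n ≈ coeff q n

  infixl 6 _+ₚ_
  _+ₚ_ : Poly → Poly → Poly
  []       +ₚ bs       = bs
  (a ∷ as) +ₚ []       = a ∷ as
  (a ∷ as) +ₚ (b ∷ bs) = (a + b) ∷ (as +ₚ bs)

  infixr 7 _*ₚ_
  _*ₚ_ : Carrier → Poly → Poly
  a *ₚ p = map (a *_) p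

  -ₚ_ : Poly → Poly
  -ₚ p = map -_ p

  const : Carrier → Poly
  const a = a ∷ []

  X : Poly
  X = 0# ∷ 1# ∷ []

  eval : Poly → Carrier → Carrier
  eval p x = foldr (λ a r → a + x * r) 0# p

  HasDegree : Poly → ℕ → Set (ℓ₁ ⊔ ℓ₂)
  HasDegree p n = (coeff p n # 0#) × (∀ m → n ℕ.< m → coeff p m ≈ 0#)

  polyRawLeftModule : RawLeftModule Carrier c ℓ₁
  polyRawLeftModule = record
    { Carrierᴹ = Poly
    ; _≈ᴹ_     = _≈ₚ_
    ; _+ᴹ_     = _+ₚ_
    ; _*ₗ_     = _*ₚ_
    ; 0ᴹ       = []
    ; -ᴹ_      = -ₚ_
    }

  open LeftModuleMorphisms polyRawLeftModule polyRawLeftModule public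
    using () renaming (IsLeftModuleHomomorphism to IsLinear)

  Operator : Set c
  Operator = Poly → Poly

  infix 4 _≈ₒ_
  _≈ₒ_ : Operator → Operator → Set (c ⊔ ℓ₁)
  S ≈ₒ T = ∀ p → S p ≈ₚ T p

module Umbral (F : HeytingField c ℓ₁ ℓ₂)
              (ψ : ℕ → HeytingField.Carrier F)
              (ψ#0 : ∀ n → HeytingField._#_ F (ψ n) (HeytingField.0# F)) where

  open Field F
  open Polynomial F

  -- n_ψ = ψₙ₋₁ / ψₙ, with ψ₋₁ = 0
  [_]ψ : ℕ → Carrier
  [ zero  ]ψ = 0#
  [ suc n ]ψ = ψ n * inverse (ψ#0 (suc n))

  -- Multiplies the i-th entry by (n + i)_ψ.
  weighted : ℕ → Poly → Poly
  weighted n []       = []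
  weighted n (a ∷ as) = ([ n ]ψ * a) ∷ weighted (suc n) as

  -- xⁿ ↦ n_ψ xⁿ⁻¹
  ∂ : Operator
  ∂ []       = []
  ∂ (_ ∷ as) = weighted 1 as

  -- Σₖ (aᵏ / k_ψ!) ∂ᵏ, where 1 / k_ψ! = ψₖ because k_ψ! = 1 / ψₖ.
  -- Every application of ∂ to a nonempty list drops one entry, so the terms
  -- with k ≥ length p vanish.
  E : Carrier → Operator
  E a p = foldr _+ₚ_ [] (map (λ k → (a ^ k * ψ k) *ₚ fold p ∂ k) (upTo (length p)))

  record Σψ (T : Operator) : Set (c ⊔ ℓ₁) where
    field
      isLinear   : IsLinear T
      commutes-E : ∀ a → (T ∘ E a) ≈ₒ (E a ∘ T)

  record IsInverseInΣψ (T T⁻¹ : Operator) : Set (c ⊔ ℓ₁) where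
    field
      inverse∈Σψ : Σψ T⁻¹
      inverseˡ   : ∀ p → T⁻¹ (T p) ≈ₚ p
      inverseʳ   : ∀ p → T (T⁻¹ p) ≈ₚ p

  record IsDelta (Q : Operator) : Set (c ⊔ ℓ₁ ⊔ ℓ₂) where
    field
      delta∈Σψ : Σψ Q
      Q-X      : ∃[ a ] (a # 0#) × (Q X ≈ₚ const a)

  record IsBasic (Q : Operator) (p : ℕ → Poly) : Set (ℓ₁ ⊔ ℓ₂) where
    field
      degree  : ∀ n → HasDegree (p n) n
      p₀      : p 0 ≈ₚ const 1#
      p[0]    : ∀ n → eval (p (suc n)) 0# ≈ 0#
      lowered : ∀ n → Q (p (suc n)) ≈ₚ [ suc n ]ψ *ₚ p n

{-# OPTIONS --safe #-}

-- Write ε for evaluation at 0.  Comparing the coefficients of the polynomials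
-- a ↦ ε(T E^a q) and a ↦ ε(E^a T q), which agree at all a, shows that every
-- T ∈ Σψ commutes with ∂; and since the coefficients of q are determined by the
-- numbers ε(∂ⁿ q), an operator commuting with ∂ is determined by ε ∘ T.  The
-- hypothesis says that ε ∘ P₀⁻¹ Q and ε ∘ ∂ agree on every pₙ, and the pₙ span.
-- Hence P₀⁻¹ Q = ∂, so Q = P₀ ∂ = ∂ P₀.
module Submission where

open import Defs
open import Algebra.Apartness.Bundles using (HeytingField; module HeytingCommutativeRing)
open import Algebra.Bundles using (module CommutativeRing)
open import Algebra.Module.Morphism.Structures using (module LeftModuleMorphisms)
import Algebra.Properties.Ring as RingProperties
import Algebra.Solver.Ring.NaturalCoefficients.Default as SemiringSolver
open import Data.List.Base using ([]; _∷_; applyUpTo; foldr; length)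
open import Data.List.Properties using (map-upTo)
open import Data.Nat.Base as ℕ using (ℕ; zero; suc; z≤n; s≤s)
import Data.Nat.Properties as ℕ
open import Data.Nat.GeneralisedArithmetic using (fold)
open import Data.Product.Base using (_×_; _,_; proj₁; proj₂)
open import Data.Sum.Base using (inj₁; inj₂)
open import Function.Base using (_∘_)
open import Level using (Level; _⊔_)
open import Relation.Binary.PropositionalEquality as ≡ using (_≡_)
import Relation.Binary.Reasoning.Setoid as ≈-Reasoning

private
  variable
    c ℓ₁ ℓ₂ : Level

-- Cancellation in a Heyting field.

module FieldProperties (F : HeytingField c ℓ₁ ℓ₂) where

  open Field F
  open HeytingCommutativeRing heytingCommutativeRing using (commutativeRing)
  open CommutativeRing commutativeRing public
    using ( refl; sym; trans; reflexive; setoid; ring; commutativeSemiring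
          ; +-cong; +-congˡ; +-congʳ; +-identityˡ; +-identityʳ; +-assoc; -‿inverseʳ; -‿cong
          ; *-cong; *-congˡ; *-congʳ; *-identityˡ; *-identityʳ; *-assoc; *-comm; zeroˡ; zeroʳ)
  open RingProperties ring public
    using (-0#≈0#; -1*x≈-x; -‿distribˡ-*; +-cancelʳ)
  open SemiringSolver commutativeSemiring public using (solve; _:=_; _:+_; _:*_)
  open ≈-Reasoning setoid

  inverseˡ : ∀ {x} (x#0 : x # 0#) → inverse x#0 * x ≈ 1#
  inverseˡ {x} x#0 = trans
    (*-congˡ (sym (trans (+-congˡ -0#≈0#) (+-identityʳ x))))
    (proj₁ (proj₂ (#⇒invertible x#0)))

  *-cancelˡ-# : ∀ {x y z} → x # 0# → x * y ≈ x * z → y ≈ z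
  *-cancelˡ-# {x} {y} {z} x#0 xy≈xz = trans (sym (cancel y)) (trans (*-congˡ xy≈xz) (cancel z))
    where
    cancel : ∀ w → inverse x#0 * (x * w) ≈ w
    cancel w = begin
      inverse x#0 * (x * w) ≈⟨ *-assoc _ _ _ ⟨
      inverse x#0 * x * w   ≈⟨ *-congʳ (inverseˡ x#0) ⟩
      1# * w                ≈⟨ *-identityˡ w ⟩
      w                     ∎

-- Coefficients and values of polynomials.

module PolynomialProperties (F : HeytingField c ℓ₁ ℓ₂) where

  open Field F
  open Polynomial F
  open FieldProperties F
  open ≈-Reasoning setoid

  coeff-+ₚ : ∀ p q n → coeff (p +ₚ q) n ≈ coeff p n + coeff q n
  coeff-+ₚ []       q        n       = sym (+-identityˡ _)
  coeff-+ₚ (a ∷ as) []       n       = sym (+-identityʳ _)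
  coeff-+ₚ (a ∷ as) (b ∷ bs) zero    = refl
  coeff-+ₚ (a ∷ as) (b ∷ bs) (suc n) = coeff-+ₚ as bs n

  coeff-*ₚ : ∀ a p n → coeff (a *ₚ p) n ≈ a * coeff p n
  coeff-*ₚ a []       n       = sym (zeroʳ a)
  coeff-*ₚ a (b ∷ bs) zero    = refl
  coeff-*ₚ a (b ∷ bs) (suc n) = coeff-*ₚ a bs n

  coeff-≥length : ∀ p {n} → length p ℕ.≤ n → coeff p n ≈ 0#
  coeff-≥length []       _         = refl
  coeff-≥length (_ ∷ as) (s≤s l≤n) = coeff-≥length as l≤n

  -- Past the end of the list `coeff` returns its default `0#`, and the vanishing hypothesis makes
  -- `f` agree with that default.
  coeff-applyUpTo : ∀ f N → (∀ k → N ℕ.≤ k → f k ≈ 0#) →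
                    ∀ k → coeff (applyUpTo f N) k ≈ f k
  coeff-applyUpTo f zero    f≈0 k       = sym (f≈0 k z≤n)
  coeff-applyUpTo f (suc N) f≈0 zero    = refl
  coeff-applyUpTo f (suc N) f≈0 (suc k) =
    coeff-applyUpTo (f ∘ suc) N (λ j N≤j → f≈0 (suc j) (s≤s N≤j)) k

  eval-0 : ∀ p → eval p 0# ≈ coeff p 0
  eval-0 []       = refl
  eval-0 (a ∷ as) = trans (+-congˡ (zeroˡ _)) (+-identityʳ a)

  eval-zero : ∀ p → p ≈ₚ [] → ∀ x → eval p x ≈ 0#
  eval-zero []       _   x = refl
  eval-zero (a ∷ as) p≈0 x = begin
    a + x * eval as x ≈⟨ +-cong (p≈0 0) (*-congˡ (eval-zero as (p≈0 ∘ suc) x)) ⟩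
    0# + x * 0#       ≈⟨ +-identityˡ _ ⟩
    x * 0#            ≈⟨ zeroʳ x ⟩
    0#                ∎

  -- Equal polynomials may be lists of different lengths. When one list runs out, the rest of the
  -- other consists of zeros and `eval-zero` applies.
  eval-cong : ∀ p q → p ≈ₚ q → ∀ x → eval p x ≈ eval q x
  eval-cong []       q        p≈q x = sym (eval-zero q (λ n → sym (p≈q n)) x)
  eval-cong (a ∷ as) []       p≈q x = eval-zero (a ∷ as) p≈q x
  eval-cong (a ∷ as) (b ∷ bs) p≈q x = +-cong (p≈q 0) (*-congˡ (eval-cong as bs (p≈q ∘ suc) x))

  eval-congˡ : ∀ p {x y} → x ≈ y → eval p x ≈ eval p y
  eval-congˡ []       x≈y = refl
  eval-congˡ (a ∷ as) x≈y = +-congˡ (*-cong x≈y (eval-congˡ as x≈y))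

  eval-+ₚ : ∀ p q x → eval (p +ₚ q) x ≈ eval p x + eval q x
  eval-+ₚ []       q        x = sym (+-identityˡ _)
  eval-+ₚ (a ∷ as) []       x = sym (+-identityʳ _)
  eval-+ₚ (a ∷ as) (b ∷ bs) x = trans (+-congˡ (*-congˡ (eval-+ₚ as bs x)))
    (solve 5 (λ a b x s t → a :+ b :+ x :* (s :+ t) := a :+ x :* s :+ (b :+ x :* t)) refl
      a b x (eval as x) (eval bs x))

  eval-*ₚ : ∀ a p x → eval (a *ₚ p) x ≈ a * eval p x
  eval-*ₚ a []       x = sym (zeroʳ a)
  eval-*ₚ a (b ∷ bs) x = trans (+-congˡ (*-congˡ (eval-*ₚ a bs x)))
    (solve 4 (λ a b x s → a :* b :+ x :* (a :* s) := a :* (b :+ x :* s)) refl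
      a b x (eval bs x))

  -- Roots of polynomials in characteristic 0.

  -- Horner's scheme: for f = a + x as(x), the quotient (f(x) − f(r)) / (x − r)
  -- depends only on as, and its coefficients are the values at r of the tails.
  quotient : Carrier → Poly → Poly
  quotient r []       = []
  quotient r (b ∷ bs) = eval (b ∷ bs) r ∷ quotient r bs

  -- The increment `s` plays the role of x - r. In this form the identity contains no subtraction,
  -- so the semiring solver can close it.
  eval-quotient : ∀ a as r s →
    eval (a ∷ as) (r + s) ≈ eval (a ∷ as) r + s * eval (quotient r as) (r + s)
  eval-quotient a []       r s = begin
    a + (r + s) * 0#     ≈⟨ +-congˡ (trans (zeroʳ _) (sym (zeroʳ r))) ⟩
    a + r * 0#           ≈⟨ +-identityʳ _ ⟨
    a + r * 0# + 0#      ≈⟨ +-congˡ (zeroʳ s) ⟨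
    a + r * 0# + s * 0#  ∎
  eval-quotient a (b ∷ bs) r s = trans
    (+-congˡ (*-congˡ (eval-quotient b bs r s)))
    (solve 5 (λ a r s v g → a :+ (r :+ s) :* (v :+ s :* g)
                         := a :+ r :* v :+ s :* (v :+ (r :+ s) :* g)) refl
      a r s (eval (b ∷ bs) r) (eval (quotient r bs) (r + s)))

  -- The system is triangular: once the tail `bs` is known to be zero, the entry `b + r * eval bs r`
  -- of the quotient reduces to `b`.
  quotient-zero : ∀ r as → quotient r as ≈ₚ [] → as ≈ₚ []
  quotient-zero r []       _   n       = refl
  quotient-zero r (b ∷ bs) g≈0 zero    = begin
    b                 ≈⟨ +-identityʳ b ⟨
    b + 0#            ≈⟨ +-congˡ (trans (*-congˡ (eval-zero bs (quotient-zero r bs (g≈0 ∘ suc)) r)) (zeroʳ r)) ⟨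
    b + r * eval bs r ≈⟨ g≈0 0 ⟩
    0#                ∎
  quotient-zero r (b ∷ bs) g≈0 (suc n) = quotient-zero r bs (g≈0 ∘ suc) n

  length-quotient : ∀ r as → length (quotient r as) ≡ length as
  length-quotient r []       = ≡.refl
  length-quotient r (b ∷ bs) = ≡.cong suc (length-quotient r bs)

  -- Dividing out the root `r` leaves a quotient that vanishes on the progression starting at
  -- `r + 1#`, so the base point must vary in the induction. The quotient is not a sublist of `f`,
  -- hence the recursion on a separate length `N`.
  vanishing⇒zero : CharZero → ∀ N f → length f ≡ N → ∀ r →
                   (∀ n → eval f (r + n · 1#) ≈ 0#) → f ≈ₚ []
  vanishing⇒zero char0 _       []       _   _ _   n = refl
  vanishing⇒zero char0 (suc N) (a ∷ as) len r f≈0 = f-zero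
    where
    root : eval (a ∷ as) r ≈ 0#
    root = trans (eval-congˡ (a ∷ as) (sym (+-identityʳ r))) (f≈0 0)

    g≈0 : ∀ n → eval (quotient r as) (r + 1# + n · 1#) ≈ 0#
    -- `suc n · 1#` unfolds to `1# + n · 1#`, so the point in question is `r + s`. Characteristic 0
    -- makes the factor `s` cancellable.
    g≈0 n = *-cancelˡ-# (char0 n) (begin
      s * eval (quotient r as) (r + 1# + n · 1#)              ≈⟨ *-congˡ (eval-congˡ (quotient r as) (+-assoc r 1# _)) ⟩
      s * eval (quotient r as) (r + s)                        ≈⟨ +-identityˡ _ ⟨
      0# + s * eval (quotient r as) (r + s)                   ≈⟨ +-congʳ root ⟨
      eval (a ∷ as) r + s * eval (quotient r as) (r + s)      ≈⟨ eval-quotient a as r s ⟨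
      eval (a ∷ as) (r + s)                                   ≈⟨ f≈0 (suc n) ⟩
      0#                                                      ≈⟨ zeroʳ s ⟨
      s * 0#                                                  ∎)
      where s = suc n · 1#

    as≈0 : as ≈ₚ []
    as≈0 = quotient-zero r as (vanishing⇒zero char0 N (quotient r as)
      (≡.trans (length-quotient r as) (ℕ.suc-injective len)) (r + 1#) g≈0)

    f-zero : a ∷ as ≈ₚ []
    f-zero zero    = begin
      a                 ≈⟨ +-identityʳ a ⟨
      a + 0#            ≈⟨ +-congˡ (trans (*-congˡ (eval-zero as as≈0 r)) (zeroʳ r)) ⟨
      a + r * eval as r ≈⟨ root ⟩
      0#                ∎
    f-zero (suc n) = as≈0 n

  -- The difference of `f` and `g` vanishes at 0, 1, 2, ..., so `vanishing⇒zero` applies to it.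
  eval-injective : CharZero → ∀ f g → (∀ x → eval f x ≈ eval g x) → f ≈ₚ g
  eval-injective char0 f g f≈g n = +-cancelʳ (- 1# * coeff g n) _ _ (begin
    coeff f n + - 1# * coeff g n ≈⟨ +-congˡ (coeff-*ₚ (- 1#) g n) ⟨
    coeff f n + coeff (- 1# *ₚ g) n ≈⟨ coeff-+ₚ f (- 1# *ₚ g) n ⟨
    coeff (f +ₚ - 1# *ₚ g) n        ≈⟨ vanishing⇒zero char0 _ (f +ₚ - 1# *ₚ g) ≡.refl 0# (λ k → diff (0# + k · 1#)) n ⟩
    0#                              ≈⟨ minus (coeff g n) ⟨
    coeff g n + - 1# * coeff g n ∎)
    where
    minus : ∀ y → y + - 1# * y ≈ 0#
    minus y = trans (+-congˡ (-1*x≈-x y)) (-‿inverseʳ y)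

    diff : ∀ x → eval (f +ₚ - 1# *ₚ g) x ≈ 0#
    diff x = begin
      eval (f +ₚ - 1# *ₚ g) x       ≈⟨ eval-+ₚ f (- 1# *ₚ g) x ⟩
      eval f x + eval (- 1# *ₚ g) x ≈⟨ +-cong (f≈g x) (eval-*ₚ (- 1#) g x) ⟩
      eval g x + - 1# * eval g x    ≈⟨ minus (eval g x) ⟩
      0#                            ∎

  -- Linear functionals and linear operators.

  -- Both `coeff` at a fixed index and its composite with a linear operator are of this kind, so one
  -- expansion of `E a` serves for either order of composition with an operator.
  record IsFunctional (φ : Poly → Carrier) : Set (c ⊔ ℓ₁) where
    field
      cong   : ∀ {p q} → p ≈ₚ q → φ p ≈ φ q
      +-homo : ∀ p q → φ (p +ₚ q) ≈ φ p + φ q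
      *-homo : ∀ a p → φ (a *ₚ p) ≈ a * φ p

    0-homo : φ [] ≈ 0#
    0-homo = trans (*-homo 0# []) (zeroˡ _)

  coeff-isFunctional : ∀ n → IsFunctional (λ p → coeff p n)
  coeff-isFunctional n = record
    { cong   = λ p≈q → p≈q n
    ; +-homo = λ p q → coeff-+ₚ p q n
    ; *-homo = λ a p → coeff-*ₚ a p n
    }

  isFunctional-∘ : ∀ {φ T} → IsFunctional φ → IsLinear T → IsFunctional (φ ∘ T)
  isFunctional-∘ φ-fun T-lin = record
    { cong   = λ p≈q → φ.cong (T.⟦⟧-cong p≈q)
    ; +-homo = λ p q → trans (φ.cong (T.+ᴹ-homo p q)) (φ.+-homo _ _)
    ; *-homo = λ a p → trans (φ.cong (T.*ₗ-homo a p)) (φ.*-homo a _)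
    }
    where
    module φ = IsFunctional φ-fun
    module T = LeftModuleMorphisms.IsLeftModuleHomomorphism T-lin

  -- Preservation of zero and of negation comes from homogeneity, with the scalars 0 and -1.
  coeffwise⇒isLinear : ∀ {T} → (∀ n → IsFunctional (λ p → coeff (T p) n)) → IsLinear T
  coeffwise⇒isLinear {T} T-fun = record
    { +ᴹ-isGroupHomomorphism = record
      { isMonoidHomomorphism = record
        { isMagmaHomomorphism = record
          { isRelHomomorphism = record { cong = λ p≈q n → T.cong n p≈q }
          ; homo              = λ p q n → trans (T.+-homo n p q) (sym (coeff-+ₚ (T p) (T q) n))
          }
        ; ε-homo = T.0-homo
        }
      ; ⁻¹-homo = λ p n → begin
          coeff (T (-ₚ p)) n      ≈⟨ T.cong n (-ₚ≈-1*ₚ p) ⟩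
          coeff (T (- 1# *ₚ p)) n ≈⟨ T.*-homo n (- 1#) p ⟩
          - 1# * coeff (T p) n    ≈⟨ coeff-*ₚ (- 1#) (T p) n ⟨
          coeff (- 1# *ₚ T p) n   ≈⟨ -ₚ≈-1*ₚ (T p) n ⟨
          coeff (-ₚ T p) n        ∎
      }
    ; *ₗ-homo = λ a p n → trans (T.*-homo n a p) (sym (coeff-*ₚ a (T p) n))
    }
    where
    module T n = IsFunctional (T-fun n)

    -ₚ≈-1*ₚ : ∀ p → -ₚ p ≈ₚ - 1# *ₚ p
    -ₚ≈-1*ₚ []       n       = refl
    -ₚ≈-1*ₚ (a ∷ as) zero    = sym (-1*x≈-x a)
    -ₚ≈-1*ₚ (a ∷ as) (suc n) = -ₚ≈-1*ₚ as n

  isLinear-resp-≈ₒ : ∀ {S T} → S ≈ₒ T → IsLinear S → IsLinear T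
  isLinear-resp-≈ₒ {S} {T} S≈T S-lin = coeffwise⇒isLinear (λ n → record
    { cong   = λ {p} {q} p≈q → trans (sym (S≈T p n)) (trans (S.cong n p≈q) (S≈T q n))
    ; +-homo = λ p q → trans (sym (S≈T (p +ₚ q) n)) (trans (S.+-homo n p q) (+-cong (S≈T p n) (S≈T q n)))
    ; *-homo = λ a p → trans (sym (S≈T (a *ₚ p) n)) (trans (S.*-homo n a p) (*-congˡ (S≈T p n)))
    })
    where module S n = IsFunctional (isFunctional-∘ (coeff-isFunctional n) S-lin)

  -- One polynomial in each degree gives a spanning set. Subtracting the multiple of `p N` that
  -- kills the coefficient at `N` lowers the degree bound, and the equality found for the remainder
  -- passes back to `q` by cancelling a common term.
  functional-ext : ∀ {φ χ} → IsFunctional φ → IsFunctional χ →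
                   ∀ (p : ℕ → Poly) → (∀ n → HasDegree (p n) n) → (∀ n → φ (p n) ≈ χ (p n)) →
                   ∀ q → φ q ≈ χ q
  functional-ext {φ} {χ} φ-fun χ-fun p deg φ≈χ q = below (length q) q (λ _ → coeff-≥length q)
    where
    module φ = IsFunctional φ-fun
    module χ = IsFunctional χ-fun

    -- `N` is only a bound on the support: the top coefficient may itself be zero, in which case `d`
    -- is zero too. No decision about vanishing coefficients is required.
    below : ∀ N q → (∀ m → N ℕ.≤ m → coeff q m ≈ 0#) → φ q ≈ χ q
    below zero    q q≈0 = begin
      φ q  ≈⟨ φ.cong (λ m → q≈0 m z≤n) ⟩
      φ [] ≈⟨ trans φ.0-homo (sym χ.0-homo) ⟩
      χ [] ≈⟨ χ.cong (λ m → q≈0 m z≤n) ⟨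
      χ q  ∎
    below (suc N) q q≈0 = +-cancelʳ (- d * φ (p N)) _ _ (begin
      φ q + - d * φ (p N) ≈⟨ trans (φ.+-homo q _) (+-congˡ (φ.*-homo (- d) (p N))) ⟨
      φ q′                ≈⟨ below N q′ q′≈0 ⟩
      χ q′                ≈⟨ trans (χ.+-homo q _) (+-congˡ (χ.*-homo (- d) (p N))) ⟩
      χ q + - d * χ (p N) ≈⟨ +-congˡ (*-congˡ (φ≈χ N)) ⟨
      χ q + - d * φ (p N) ∎)
      where
      lead#0 = proj₁ (deg N)
      d      = coeff q N * inverse lead#0
      q′     = q +ₚ - d *ₚ p N

      coeff-q′ : ∀ m → coeff q′ m ≈ coeff q m + - d * coeff (p N) m
      coeff-q′ m = trans (coeff-+ₚ q (- d *ₚ p N) m) (+-congˡ (coeff-*ₚ (- d) (p N) m))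

      q′≈0 : ∀ m → N ℕ.≤ m → coeff q′ m ≈ 0#
      q′≈0 m N≤m with ℕ.m≤n⇒m<n∨m≡n N≤m
      ... | inj₁ N<m = begin
        coeff q′ m                        ≈⟨ coeff-q′ m ⟩
        coeff q m + - d * coeff (p N) m   ≈⟨ +-cong (q≈0 m N<m) (*-congˡ (proj₂ (deg N) m N<m)) ⟩
        0# + - d * 0#                     ≈⟨ +-identityˡ _ ⟩
        - d * 0#                          ≈⟨ zeroʳ _ ⟩
        0#                                ∎
      ... | inj₂ ≡.refl = begin
        coeff q′ N                        ≈⟨ coeff-q′ N ⟩
        coeff q N + - d * coeff (p N) N   ≈⟨ +-congˡ (-‿distribˡ-* d _) ⟨
        coeff q N + - (d * coeff (p N) N) ≈⟨ +-congˡ (-‿cong (trans (*-assoc _ _ _) (trans (*-congˡ (inverseˡ lead#0)) (*-identityʳ _)))) ⟩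
        coeff q N + - coeff q N           ≈⟨ -‿inverseʳ _ ⟩
        0#                                ∎

-- The ψ-derivative and its powers.

module UmbralProperties (F : HeytingField c ℓ₁ ℓ₂)
                        (ψ : ℕ → HeytingField.Carrier F)
                        (ψ#0 : ∀ n → HeytingField._#_ F (ψ n) (HeytingField.0# F)) where

  open Field F
  open Polynomial F
  open Umbral F ψ ψ#0
  open FieldProperties F
  open PolynomialProperties F
  open ≈-Reasoning setoid

  coeff-∂ : ∀ p n → coeff (∂ p) n ≈ [ suc n ]ψ * coeff p (suc n)
  coeff-∂ []       n = sym (zeroʳ _)
  coeff-∂ (_ ∷ as) n = coeff-weighted 1 as n
    where
    coeff-weighted : ∀ m as n → coeff (weighted m as) n ≈ [ m ℕ.+ n ]ψ * coeff as n
    coeff-weighted m []       n       = sym (zeroʳ _)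
    coeff-weighted m (a ∷ as) zero    = *-congʳ (reflexive (≡.cong [_]ψ (≡.sym (ℕ.+-identityʳ m))))
    coeff-weighted m (a ∷ as) (suc n) = trans (coeff-weighted (suc m) as n)
      (*-congʳ (reflexive (≡.cong [_]ψ (≡.sym (ℕ.+-suc m n)))))

  -- Multiplying by `ψ (suc n)` clears the denominator of the ψ-integer and leaves the factor `ψ n`,
  -- which is apart from zero.
  *-cancelˡ-[]ψ : ∀ n {x y} → [ suc n ]ψ * x ≈ [ suc n ]ψ * y → x ≈ y
  *-cancelˡ-[]ψ n {x} {y} nx≈ny = *-cancelˡ-# (ψ#0 n) (begin
    ψ n * x                        ≈⟨ clear x ⟨
    ψ (suc n) * ([ suc n ]ψ * x)   ≈⟨ *-congˡ nx≈ny ⟩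
    ψ (suc n) * ([ suc n ]ψ * y)   ≈⟨ clear y ⟩
    ψ n * y                        ∎)
    where
    clear : ∀ z → ψ (suc n) * ([ suc n ]ψ * z) ≈ ψ n * z
    clear z = begin
      ψ (suc n) * (ψ n * inverse (ψ#0 (suc n)) * z)   ≈⟨ solve 4 (λ s t i z → s :* (t :* i :* z) := i :* s :* (t :* z)) refl (ψ (suc n)) (ψ n) (inverse (ψ#0 (suc n))) z ⟩
      inverse (ψ#0 (suc n)) * ψ (suc n) * (ψ n * z)   ≈⟨ *-congʳ (inverseˡ (ψ#0 (suc n))) ⟩
      1# * (ψ n * z)                                  ≈⟨ *-identityˡ _ ⟩
      ψ n * z                                         ∎

  ∂-isLinear : IsLinear ∂
  ∂-isLinear = coeffwise⇒isLinear (λ n → record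
    { cong   = λ {p} {q} p≈q → trans (coeff-∂ p n) (trans (*-congˡ (p≈q (suc n))) (sym (coeff-∂ q n)))
    ; +-homo = λ p q → begin
        coeff (∂ (p +ₚ q)) n                         ≈⟨ coeff-∂ (p +ₚ q) n ⟩
        [ suc n ]ψ * coeff (p +ₚ q) (suc n)          ≈⟨ *-congˡ (coeff-+ₚ p q (suc n)) ⟩
        [ suc n ]ψ * (coeff p (suc n) + coeff q (suc n))
          ≈⟨ solve 3 (λ s x y → s :* (x :+ y) := s :* x :+ s :* y) refl [ suc n ]ψ _ _ ⟩
        [ suc n ]ψ * coeff p (suc n) + [ suc n ]ψ * coeff q (suc n)
          ≈⟨ +-cong (coeff-∂ p n) (coeff-∂ q n) ⟨
        coeff (∂ p) n + coeff (∂ q) n                ∎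
    ; *-homo = λ a p → begin
        coeff (∂ (a *ₚ p)) n                     ≈⟨ coeff-∂ (a *ₚ p) n ⟩
        [ suc n ]ψ * coeff (a *ₚ p) (suc n)      ≈⟨ *-congˡ (coeff-*ₚ a p (suc n)) ⟩
        [ suc n ]ψ * (a * coeff p (suc n))       ≈⟨ solve 3 (λ s a x → s :* (a :* x) := a :* (s :* x)) refl [ suc n ]ψ a _ ⟩
        a * ([ suc n ]ψ * coeff p (suc n))       ≈⟨ *-congˡ (coeff-∂ p n) ⟨
        a * coeff (∂ p) n                        ∎
    })

  ∂-cong : ∀ p q → p ≈ₚ q → ∂ p ≈ₚ ∂ q
  ∂-cong p q = LeftModuleMorphisms.IsLeftModuleHomomorphism.⟦⟧-cong ∂-isLinear {p} {q}

  ∂ᵏ-cong : ∀ p q → p ≈ₚ q → ∀ k → fold p ∂ k ≈ₚ fold q ∂ k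
  ∂ᵏ-cong p q p≈q zero    = p≈q
  ∂ᵏ-cong p q p≈q (suc k) = ∂-cong (fold p ∂ k) (fold q ∂ k) (∂ᵏ-cong p q p≈q k)

  -- Each application of `∂` moves coefficients down by one place, so coefficient `n` of the `k`-th
  -- derivative is a multiple of coefficient `k + n` of `p`.
  ∂ᵏ-vanishes : ∀ p k n → length p ℕ.≤ k ℕ.+ n → coeff (fold p ∂ k) n ≈ 0#
  ∂ᵏ-vanishes p zero    n l≤n = coeff-≥length p l≤n
  ∂ᵏ-vanishes p (suc k) n l≤n = trans (coeff-∂ (fold p ∂ k) n) (trans
    (*-congˡ (∂ᵏ-vanishes p k (suc n) (ℕ.≤-trans l≤n (ℕ.≤-reflexive (≡.sym (ℕ.+-suc k n))))))
    (zeroʳ _))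

  -- Generalised shifts as polynomials in their parameter.

  -- φ (E a p), as a polynomial in a.
  E-poly : (Poly → Carrier) → Poly → Poly
  E-poly φ p = applyUpTo (λ k → ψ k * φ (fold p ∂ k)) (length p)

  -- The formula holds for every `k`, since the derivatives of `p` vanish from order `length p` on.
  -- Expansions truncated at different lengths can thus be compared.
  coeff-E-poly : ∀ {φ} → IsFunctional φ → ∀ p k → coeff (E-poly φ p) k ≈ ψ k * φ (fold p ∂ k)
  coeff-E-poly {φ} φ-fun p = coeff-applyUpTo (λ k → ψ k * φ (fold p ∂ k)) (length p) λ k l≤k → begin
    ψ k * φ (fold p ∂ k) ≈⟨ *-congˡ (φ.cong (λ n → ∂ᵏ-vanishes p k n (ℕ.≤-trans l≤k (ℕ.m≤m+n k n)))) ⟩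
    ψ k * φ []           ≈⟨ *-congˡ φ.0-homo ⟩
    ψ k * 0#             ≈⟨ zeroʳ _ ⟩
    0#                   ∎
    where module φ = IsFunctional φ-fun

  eval-E-poly : ∀ {φ} → IsFunctional φ → ∀ a p → φ (E a p) ≈ eval (E-poly φ p) a
  eval-E-poly {φ} φ-fun a p = begin
    φ (E a p)
      ≡⟨ ≡.cong (λ ts → φ (foldr _+ₚ_ [] ts)) (map-upTo (λ k → (a ^ k * ψ k) *ₚ fold p ∂ k) (length p)) ⟩
    φ (foldr _+ₚ_ [] (applyUpTo (λ k → (a ^ k * ψ k) *ₚ fold p ∂ k) (length p)))
      -- The factor `1#` in the result is `a ^ 0`, the first term of the geometric sequence.
      ≈⟨ series (a ^_) (λ _ → refl) ψ (fold p ∂) (length p) ⟩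
    1# * eval (E-poly φ p) a
      ≈⟨ *-identityˡ _ ⟩
    eval (E-poly φ p) a ∎
    where
    module φ = IsFunctional φ-fun

    -- Powers of a are generalised to a geometric sequence e, so that the
    -- induction can drop the first term.
    series : ∀ e → (∀ k → e (suc k) ≈ a * e k) → ∀ w q N →
             φ (foldr _+ₚ_ [] (applyUpTo (λ k → (e k * w k) *ₚ q k) N))
               ≈ e 0 * eval (applyUpTo (λ k → w k * φ (q k)) N) a
    series e geom w q zero    = trans φ.0-homo (sym (zeroʳ _))
    series e geom w q (suc N) = begin
      φ ((e 0 * w 0) *ₚ q 0 +ₚ rest)        ≈⟨ φ.+-homo _ rest ⟩
      φ ((e 0 * w 0) *ₚ q 0) + φ rest       ≈⟨ +-cong (φ.*-homo _ _) (series (e ∘ suc) (geom ∘ suc) (w ∘ suc) (q ∘ suc) N) ⟩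
      e 0 * w 0 * φ (q 0) + e 1 * v         ≈⟨ +-congˡ (*-congʳ (geom 0)) ⟩
      e 0 * w 0 * φ (q 0) + a * e 0 * v     ≈⟨ solve 5 (λ e w f a v → e :* w :* f :+ a :* e :* v := e :* (w :* f :+ a :* v)) refl (e 0) (w 0) (φ (q 0)) a v ⟩
      e 0 * (w 0 * φ (q 0) + a * v)         ∎
      where
      rest = foldr _+ₚ_ [] (applyUpTo (λ k → (e (suc k) * w (suc k)) *ₚ q (suc k)) N)
      v    = eval (applyUpTo (λ k → w (suc k) * φ (q (suc k))) N) a

  -- `E a` sums as many terms as the list has entries, so equal polynomials can give sums of
  -- different lengths. Their expansions in powers of `a` nevertheless have the same coefficients.
  E-cong : ∀ a p q → p ≈ₚ q → E a p ≈ₚ E a q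
  E-cong a p q p≈q n = begin
    coeff (E a p) n                           ≈⟨ eval-E-poly coeffₙ a p ⟩
    eval (E-poly (λ r → coeff r n) p) a       ≈⟨ eval-cong (E-poly (λ r → coeff r n) p) (E-poly (λ r → coeff r n) q) polys≈ a ⟩
    eval (E-poly (λ r → coeff r n) q) a       ≈⟨ eval-E-poly coeffₙ a q ⟨
    coeff (E a q) n                           ∎
    where
    coeffₙ = coeff-isFunctional n

    polys≈ : E-poly (λ r → coeff r n) p ≈ₚ E-poly (λ r → coeff r n) q
    polys≈ k = trans (coeff-E-poly coeffₙ p k)
      (trans (*-congˡ (∂ᵏ-cong p q p≈q k n)) (sym (coeff-E-poly coeffₙ q k)))

  -- Operators that commute with the ψ-derivative.

  -- For each `n`, coefficient `n` of both sides of `commutes-E` is a polynomial in `a`. In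
  -- characteristic 0 these polynomials coincide, and their linear terms carry `T (∂ p)` and
  -- `∂ (T p)` with the common factor `ψ 1`.
  Σψ-commutes-∂ : CharZero → ∀ {T} → Σψ T → T ∘ ∂ ≈ₒ ∂ ∘ T
  Σψ-commutes-∂ char0 {T} T∈Σψ p n = *-cancelˡ-# (ψ#0 1) (begin
    ψ 1 * coeff (T (∂ p)) n   ≈⟨ coeff-E-poly T-coeffₙ p 1 ⟨
    coeff (E-poly (λ r → coeff (T r) n) p) 1
      ≈⟨ eval-injective char0 (E-poly (λ r → coeff (T r) n) p) (E-poly (λ r → coeff r n) (T p)) evals≈ 1 ⟩
    coeff (E-poly (λ r → coeff r n) (T p)) 1
                              ≈⟨ coeff-E-poly coeffₙ (T p) 1 ⟩
    ψ 1 * coeff (∂ (T p)) n   ∎)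
    where
    open Σψ T∈Σψ
    coeffₙ   = coeff-isFunctional n
    T-coeffₙ = isFunctional-∘ coeffₙ isLinear

    evals≈ : ∀ a → eval (E-poly (λ r → coeff (T r) n) p) a ≈ eval (E-poly (λ r → coeff r n) (T p)) a
    evals≈ a = begin
      eval (E-poly (λ r → coeff (T r) n) p) a   ≈⟨ eval-E-poly T-coeffₙ a p ⟨
      coeff (T (E a p)) n                       ≈⟨ commutes-E a p n ⟩
      coeff (E a (T p)) n                       ≈⟨ eval-E-poly coeffₙ a (T p) ⟩
      eval (E-poly (λ r → coeff r n) (T p)) a   ∎

  -- Up to a cancellable ψ-integer, coefficient `suc n` of `S p` is coefficient `n` of `S (∂ p)`.
  -- Induction on `n`, with `p` varying, descends to the constant term.
  ∂-commuting-ext : ∀ S T → S ∘ ∂ ≈ₒ ∂ ∘ S → T ∘ ∂ ≈ₒ ∂ ∘ T →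
                    (∀ p → coeff (S p) 0 ≈ coeff (T p) 0) → S ≈ₒ T
  ∂-commuting-ext S T S∂≈∂S T∂≈∂T ε≈ p zero    = ε≈ p
  ∂-commuting-ext S T S∂≈∂S T∂≈∂T ε≈ p (suc n) = *-cancelˡ-[]ψ n (begin
    [ suc n ]ψ * coeff (S p) (suc n)   ≈⟨ coeff-∂ (S p) n ⟨
    coeff (∂ (S p)) n                  ≈⟨ S∂≈∂S p n ⟨
    coeff (S (∂ p)) n                  ≈⟨ ∂-commuting-ext S T S∂≈∂S T∂≈∂T ε≈ (∂ p) n ⟩
    coeff (T (∂ p)) n                  ≈⟨ T∂≈∂T p n ⟩
    coeff (∂ (T p)) n                  ≈⟨ coeff-∂ (T p) n ⟩
    [ suc n ]ψ * coeff (T p) (suc n)   ∎)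

  Σψ-resp-≈ₒ : ∀ {S T} → S ≈ₒ T → Σψ S → Σψ T
  Σψ-resp-≈ₒ {S} {T} S≈T S∈Σψ = record
    { isLinear   = isLinear-resp-≈ₒ S≈T isLinear
    ; commutes-E = λ a p n → begin
        coeff (T (E a p)) n   ≈⟨ S≈T (E a p) n ⟨
        coeff (S (E a p)) n   ≈⟨ commutes-E a p n ⟩
        coeff (E a (S p)) n   ≈⟨ E-cong a (S p) (T p) (S≈T p) n ⟩
        coeff (E a (T p)) n   ∎
    }
    where open Σψ S∈Σψ

  -- Lets `∂ ∘ P₀` inherit the delta property from `Q`, without computing `P₀ X`.
  isDelta-resp-≈ₒ : ∀ {S T} → S ≈ₒ T → IsDelta S → IsDelta T
  isDelta-resp-≈ₒ S≈T S-delta = record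
    { delta∈Σψ = Σψ-resp-≈ₒ S≈T (IsDelta.delta∈Σψ S-delta)
    ; Q-X      = let a , a#0 , SX≈a = IsDelta.Q-X S-delta in
                 a , a#0 , λ n → trans (sym (S≈T X n)) (SX≈a n)
    }

  isBasic-resp-≈ₒ : ∀ {S T p} → S ≈ₒ T → IsBasic S p → IsBasic T p
  isBasic-resp-≈ₒ {p = p} S≈T S-basic = record
    { degree  = degree
    ; p₀      = p₀
    ; p[0]    = p[0]
    ; lowered = λ n m → trans (sym (S≈T (p (suc n)) m)) (lowered n m)
    }
    where open IsBasic S-basic

  -- With this normalisation the coefficient of x in a polynomial is the constant term of its
  -- ψ-derivative.
  []ψ-1 : ψ 0 ≈ 1# → ψ 1 ≈ 1# → [ 1 ]ψ ≈ 1#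
  []ψ-1 ψ₀≈1 ψ₁≈1 = begin
    ψ 0 * inverse (ψ#0 1)   ≈⟨ *-congʳ (trans ψ₀≈1 (sym ψ₁≈1)) ⟩
    ψ 1 * inverse (ψ#0 1)   ≈⟨ *-comm _ _ ⟩
    inverse (ψ#0 1) * ψ 1   ≈⟨ inverseˡ (ψ#0 1) ⟩
    1#                      ∎

  -- Since 1 is the ψ-derivative of `X` and `Q` commutes with `∂`, the image of 1 is the
  -- ψ-derivative of the constant `Q X`.
  delta-annihilates-const : CharZero → [ 1 ]ψ ≈ 1# → ∀ {Q} → IsDelta Q → Q (const 1#) ≈ₚ []
  delta-annihilates-const char0 1ψ≈1 {Q} Q-delta n =
    let a , _ , QX≈a = Q-X in begin
    coeff (Q (const 1#)) n   ≈⟨ Q.⟦⟧-cong 1≈∂X n ⟩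
    coeff (Q (∂ X)) n        ≈⟨ Σψ-commutes-∂ char0 delta∈Σψ X n ⟩
    coeff (∂ (Q X)) n        ≈⟨ ∂-cong (Q X) (const a) QX≈a n ⟩
    0#                       ∎
    where
    open IsDelta Q-delta
    module Q = LeftModuleMorphisms.IsLeftModuleHomomorphism (Σψ.isLinear delta∈Σψ)

    1≈∂X : const 1# ≈ₚ ∂ X
    1≈∂X zero    = sym (trans (*-identityʳ _) 1ψ≈1)
    1≈∂X (suc _) = refl

-- Identification of the delta operator.

mainTheorem13 : ∀ {c ℓ₁ ℓ₂} (F : HeytingField c ℓ₁ ℓ₂) →
    let open Field F
        open Polynomial F in
    CharZero →
    (ψ : ℕ → Carrier) (ψ₀≈1 : ψ 0 ≈ 1#) (ψ#0 : ∀ n → ψ n # 0#) →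
    (ψ₁≈1 : ψ 1 ≈ 1#) →
    let open Umbral F ψ ψ#0 in
    (P₀ P₀⁻¹ : Operator) → Σψ P₀ → IsInverseInΣψ P₀ P₀⁻¹ →
    (Q : Operator) → IsDelta Q →
    (p : ℕ → Poly) → IsBasic Q p →
    (∀ n → coeff (p (suc n)) 1 ≈ [ suc n ]ψ * eval (P₀⁻¹ (p n)) 0#) →
    (Q ≈ₒ ∂ ∘ P₀) × IsDelta (∂ ∘ P₀) × IsBasic (∂ ∘ P₀) p
mainTheorem13 F char0 ψ ψ₀≈1 ψ#0 ψ₁≈1 P₀ P₀⁻¹ P₀∈Σψ P₀-inv Q Q-delta p p-basic hyp =
  Q≈∂P₀ , isDelta-resp-≈ₒ Q≈∂P₀ Q-delta , isBasic-resp-≈ₒ Q≈∂P₀ p-basic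
  where
  open Field F
  open Polynomial F
  open Umbral F ψ ψ#0
  open FieldProperties F
  open PolynomialProperties F
  open UmbralProperties F ψ ψ#0
  open ≈-Reasoning setoid
  open IsInverseInΣψ P₀-inv using (inverse∈Σψ; inverseʳ)
  open IsDelta Q-delta using (delta∈Σψ)
  open IsBasic p-basic
  module P₀   = LeftModuleMorphisms.IsLeftModuleHomomorphism (Σψ.isLinear P₀∈Σψ)
  module P₀⁻¹ = LeftModuleMorphisms.IsLeftModuleHomomorphism (Σψ.isLinear inverse∈Σψ)
  module Q    = LeftModuleMorphisms.IsLeftModuleHomomorphism (Σψ.isLinear delta∈Σψ)

  1ψ≈1 : [ 1 ]ψ ≈ 1#
  1ψ≈1 = []ψ-1 ψ₀≈1 ψ₁≈1

  agree-on-basis : ∀ n → coeff (P₀⁻¹ (Q (p n))) 0 ≈ coeff (∂ (p n)) 0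
  -- `lowered` and `hyp` concern only positive indices; at index 0 both sides vanish because `p 0`
  -- is the constant 1.
  agree-on-basis zero    = begin
    coeff (P₀⁻¹ (Q (p 0))) 0   ≈⟨ P₀⁻¹.⟦⟧-cong Qp₀≈0 0 ⟩
    coeff (P₀⁻¹ []) 0          ≈⟨ P₀⁻¹.0ᴹ-homo 0 ⟩
    0#                         ≈⟨ ∂-cong (p 0) (const 1#) p₀ 0 ⟨
    coeff (∂ (p 0)) 0          ∎
    where
    Qp₀≈0 : Q (p 0) ≈ₚ []
    Qp₀≈0 n = trans (Q.⟦⟧-cong p₀ n) (delta-annihilates-const char0 1ψ≈1 Q-delta n)
  agree-on-basis (suc n) = begin
    coeff (P₀⁻¹ (Q (p (suc n)))) 0         ≈⟨ P₀⁻¹.⟦⟧-cong (lowered n) 0 ⟩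
    coeff (P₀⁻¹ ([ suc n ]ψ *ₚ p n)) 0     ≈⟨ P₀⁻¹.*ₗ-homo [ suc n ]ψ (p n) 0 ⟩
    coeff ([ suc n ]ψ *ₚ P₀⁻¹ (p n)) 0     ≈⟨ coeff-*ₚ [ suc n ]ψ (P₀⁻¹ (p n)) 0 ⟩
    [ suc n ]ψ * coeff (P₀⁻¹ (p n)) 0      ≈⟨ *-congˡ (eval-0 (P₀⁻¹ (p n))) ⟨
    [ suc n ]ψ * eval (P₀⁻¹ (p n)) 0#      ≈⟨ hyp n ⟨
    coeff (p (suc n)) 1                    ≈⟨ *-identityˡ _ ⟨
    -- The factor `1#` is inserted to be read as the ψ-integer of 1, which turns the coefficient of
    -- x into a constant term of `∂`.
    1# * coeff (p (suc n)) 1               ≈⟨ *-congʳ 1ψ≈1 ⟨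
    [ 1 ]ψ * coeff (p (suc n)) 1           ≈⟨ coeff-∂ (p (suc n)) 0 ⟨
    coeff (∂ (p (suc n))) 0                ∎

  P₀⁻¹Q≈∂ : P₀⁻¹ ∘ Q ≈ₒ ∂
  P₀⁻¹Q≈∂ = ∂-commuting-ext (P₀⁻¹ ∘ Q) ∂
    -- The derivative is moved first past `Q`, then past `P₀⁻¹`.
    (λ q n → trans (P₀⁻¹.⟦⟧-cong (Σψ-commutes-∂ char0 delta∈Σψ q) n)
                   (Σψ-commutes-∂ char0 inverse∈Σψ (Q q) n))
    (λ _ _ → refl)
    (functional-ext
      (isFunctional-∘ (isFunctional-∘ (coeff-isFunctional 0) (Σψ.isLinear inverse∈Σψ)) (Σψ.isLinear delta∈Σψ))
      (isFunctional-∘ (coeff-isFunctional 0) ∂-isLinear)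
      p degree agree-on-basis)

  Q≈∂P₀ : Q ≈ₒ ∂ ∘ P₀
  Q≈∂P₀ q n = begin
    coeff (Q q) n               ≈⟨ inverseʳ (Q q) n ⟨
    coeff (P₀ (P₀⁻¹ (Q q))) n   ≈⟨ P₀.⟦⟧-cong (P₀⁻¹Q≈∂ q) n ⟩
    coeff (P₀ (∂ q)) n          ≈⟨ Σψ-commutes-∂ char0 P₀∈Σψ q n ⟩
    coeff (∂ (P₀ q)) n          ∎
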